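{- The Minimum Compare Set problem is approximable in polynomial time within a factor $O(\log|B|)$: there is a polynomial-time algorithm which, given a finite set $A=\{a_1,\dots,a_m\}$ and a collection $B=\{b_1,\dots,b_n\}$ of subsets of $A$, outputs a compare set for $(A,B)$ whose cardinality is at most $O(\log|B|)$ times the minimum cardinality of a compare set for $(A,B)$.
   Context: A subset $X\subseteq A$ is called a compare set for $(A,B)$ if for any two sets $b_i,b_j\in B$, $b_i\subseteq b_j$ if and only if $(b_i\cap X)\subseteq(b_j\cap X)$. The Minimum Compare Set problem asks, given $(A,B)$, for a compare set of minimum cardinality. -}

module Defs where

open import Data.Bool.Base using (Bool; true; false)
open import Data.Fin.Base using (Fin; zero)
open import Data.Fin.Subset using (Subset; _⊆_; _∩_; ∣_∣)
open import Data.List.Base using (List; []; _∷_; map)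
open import Data.Nat.Base using (ℕ; suc; _+_; _*_; _^_; _≤_)
open import Data.Product.Base using (Σ; ∃; ∃₂; _×_; _,_)
open import Data.Vec.Base using (Vec; lookup; toList; replicate; _[_]≔_)
  renaming (_∷_ to _∷ᵛ_)
open import Function.Bundles using (_⇔_)
open import Function.Definitions using (Injective)
open import Relation.Binary.PropositionalEquality using (_≡_; _≢_)

------------------------------------------------------------------------
-- Model of computation
--
-- The WHILE language over binary trees, with its usual running-time
-- measure (N. D. Jones, "Computability and Complexity from a Programming
-- Perspective"): every evaluated operation, assignment and test costs one
-- unit.  Its polynomial-time class is that of Turing machines.  A value
-- may have exponentially many nodes when written out as a tree (iterate
-- X := cons X X), but trees are only built by cons and only inspected by
-- hd, tl and the test "≠ nil", so an implementation by shared pointers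
-- carries out each unit of time by a constant number of pointer
-- operations and allocates at most one cell in it.

data Tree : Set where
  nil  : Tree
  cons : Tree → Tree → Tree

size : Tree → ℕ
size nil        = 1
size (cons s t) = 1 + size s + size t

head : Tree → Tree
head nil        = nil
head (cons s _) = s

tail : Tree → Tree
tail nil        = nil
tail (cons _ t) = t

data Exp (k : ℕ) : Set where
  var   : Fin k → Exp k
  nil   : Exp k
  cons  : Exp k → Exp k → Exp k
  hd tl : Exp k → Exp k

infix  6 _:=_
infixr 5 _⨾_

data Com (k : ℕ) : Set where
  _:=_          : Fin k → Exp k → Com k
  _⨾_           : Com k → Com k → Com k
  if_then_else_ : Exp k → Com k → Com k → Com k
  while_loop_   : Exp k → Com k → Com k

Store : ℕ → Set
Store = Vec Tree

eval : ∀ {k} → Exp k → Store k → Tree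
eval (var x)    σ = lookup σ x
eval nil        σ = nil
eval (cons e f) σ = cons (eval e σ) (eval f σ)
eval (hd e)     σ = head (eval e σ)
eval (tl e)     σ = tail (eval e σ)

cost : ∀ {k} → Exp k → ℕ
cost (var x)    = 1
cost nil        = 1
cost (cons e f) = 1 + cost e + cost f
cost (hd e)     = 1 + cost e
cost (tl e)     = 1 + cost e

-- Exec c σ t σ′: started in σ, the command c halts in σ′ after time t.
-- Any tree other than nil counts as true.

data Exec {k : ℕ} : Com k → Store k → ℕ → Store k → Set where
  assign     : ∀ {x e σ} →
               Exec (x := e) σ (1 + cost e) (σ [ x ]≔ eval e σ)
  seq        : ∀ {c d σ₁ σ₂ σ₃ s t} →
               Exec c σ₁ s σ₂ → Exec d σ₂ t σ₃ →
               Exec (c ⨾ d) σ₁ (s + t) σ₃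
  if-true    : ∀ {e c d σ σ′ t} → eval e σ ≢ nil → Exec c σ t σ′ →
               Exec (if e then c else d) σ (1 + cost e + t) σ′
  if-false   : ∀ {e c d σ σ′ t} → eval e σ ≡ nil → Exec d σ t σ′ →
               Exec (if e then c else d) σ (1 + cost e + t) σ′
  while-true : ∀ {e c σ₁ σ₂ σ₃ s t} → eval e σ₁ ≢ nil →
               Exec c σ₁ s σ₂ → Exec (while e loop c) σ₂ t σ₃ →
               Exec (while e loop c) σ₁ (1 + cost e + s + t) σ₃
  while-done : ∀ {e c σ} → eval e σ ≡ nil →
               Exec (while e loop c) σ (1 + cost e) σ

-- Variable 0 holds the input at the start and the output at the end; the
-- k work variables are initially nil.

Program : Set
Program = Σ ℕ λ k → Com (suc k)

Runs : Program → Tree → ℕ → Tree → Set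
Runs (k , c) input t output =
  ∃ λ σ → Exec c (input ∷ᵛ replicate k nil) t σ × lookup σ zero ≡ output

-- As size is always at least 1, every polynomial in the size of the input
-- is bounded by one of the form a * size ^ d.

PolyTimeComputable : {I : Set} {S : I → Set} →
                     (I → Tree) → (∀ {i} → S i → Tree) →
                     (∀ i → S i) → Set
PolyTimeComputable {I} encodeInput encodeOutput f =
  ∃ λ (p : Program) → ∃₂ λ (a d : ℕ) → ∀ (i : I) → ∃ λ (t : ℕ) →
    t ≤ a * size (encodeInput i) ^ d ×
    Runs p (encodeInput i) t (encodeOutput (f i))

------------------------------------------------------------------------
-- Minimum Compare Set

-- A = {a₁ , … , aₘ} is represented by Fin m, and B = {b₁ , … , bₙ} by an
-- enumeration without repetitions, so that |B| = n.

record Instance : Set where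
  field
    m n      : ℕ
    B        : Vec (Subset m) n
    distinct : Injective _≡_ _≡_ (lookup B)

open Instance public

IsCompareSet : (I : Instance) → Subset (m I) → Set
IsCompareSet I X = ∀ (i j : Fin (n I)) →
  (b i ⊆ b j) ⇔ ((b i ∩ X) ⊆ (b j ∩ X))
  where
  b : Fin (n I) → Subset (m I)
  b = lookup (B I)

IsMinimumCompareSet : (I : Instance) → Subset (m I) → Set
IsMinimumCompareSet I X =
  IsCompareSet I X × (∀ Y → IsCompareSet I Y → ∣ X ∣ ≤ ∣ Y ∣)

------------------------------------------------------------------------
-- Encodings

encodeBool : Bool → Tree
encodeBool false = nil
encodeBool true  = cons nil nil

encodeList : List Tree → Tree
encodeList []       = nil
encodeList (t ∷ ts) = cons t (encodeList ts)

encodeSubset : ∀ {m} → Subset m → Tree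
encodeSubset X = encodeList (map encodeBool (toList X))

-- The list of the elements of A (m copies of nil: only their positions
-- matter), paired with the list of the characteristic vectors of the
-- members of B.

encodeInstance : Instance → Tree
encodeInstance I =
  cons (encodeList (toList (replicate (m I) nil)))
       (encodeList (map encodeSubset (toList (B I))))

{-# OPTIONS --safe #-}

-- X is a compare set iff every pair (bᵢ , bⱼ) that is separated by some
-- position x (x ∈ bᵢ, x ∉ bⱼ) is separated by a position in X, so this is
-- the hitting set problem for at most n² nonempty sets bᵢ ∖ bⱼ.  The greedy
-- algorithm is run with a threshold that descends from the number of pairs
-- to 1: a position is picked when it separates at least that many of the
-- remaining pairs.  As no position ever separates more pairs than the
-- threshold, each pick separates at least a fraction 1/k of the pairs that an
-- optimal solution of size k separates, and k picks halve their number.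

module Submission where

open import Defs
open import Data.Bool.Base using (Bool; true; false; not; _∧_; _∨_)
open import Data.Fin.Base using (Fin; zero; suc; toℕ)
open import Data.Fin.Patterns using (0F; 1F; 2F; 3F; 4F; 5F; 6F; 7F; 8F; 9F)
open import Data.Fin.Properties using (toℕ-injective)
open import Data.Fin.Subset using (Subset; ∣_∣; _⊆_; _∩_; _∈_; _∉_; ⊥)
open import Data.Fin.Subset.Properties
  using (x∈p∩q⁺; x∈p∩q⁻; _∈?_; ∣⊥∣≡0; ∣p∣≤∣x∷p∣)
open import Data.List.Base
  using (List; []; _∷_; length; filterᵇ; _ʳ++_; cartesianProduct; map)
open import Data.List.Membership.Propositional using () renaming (_∈_ to _∈ₗ_)
open import Data.List.Membership.Propositional.Properties
  using (∈-cartesianProduct⁺; ∈-cartesianProduct⁻)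
open import Data.List.Properties
  using (length-++; length-ʳ++; length-filter; length-map; ++-ʳ++; ʳ++-ʳ++; ++-identityʳ)
open import Data.List.Relation.Unary.All as All using (All; []; _∷_)
open import Data.Nat.Base
open import Data.Nat.Logarithm using (⌊log₂_⌋; ⌊log₂⌋-mono-≤; ⌊log₂[2^n]⌋≡n)
open import Data.Nat.Properties
open import Data.Nat.Tactic.RingSolver using (solve-∀)
open import Data.Product.Base using (∃; ∃₂; _×_; _,_; proj₁; proj₂; map₁)
open import Data.Sum.Base using (inj₁; inj₂)
open import Data.Vec.Base using (Vec; []; _∷_; lookup; toList; replicate; _[_]≔_)
open import Data.Vec.Membership.Propositional.Properties using (∈-lookup; ∈-toList⁺)
open import Data.Vec.Properties using (lookup⇒[]=; []=⇒lookup; length-toList)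
open import Function.Base using (_∘_; id)
open import Function.Bundles using (_⇔_; mk⇔; Equivalence)
open import Relation.Binary.PropositionalEquality
open import Relation.Nullary using (Dec; yes; no; contradiction)

private
  variable
    A : Set
    l r k : ℕ

-- Greedy covering

-- h bounds what remains to be covered; a pick of θ is greedy when θ is at least
-- a fraction 1/k of it, k being the size of an optimal cover.
data Greedy (k : ℕ) : ℕ → ℕ → Set where
  stop : ∀ {h} → Greedy k h 0
  pick : ∀ {h h′ θ p} → 1 ≤ θ → h ≤ k * θ → h′ + θ ≤ h →
         Greedy k h′ p → Greedy k h (suc p)

greedy-empty : ∀ {k p} → Greedy k 0 p → p ≡ 0
greedy-empty stop = refl
greedy-empty (pick {h′ = h′} 1≤θ _ fits _) =
  contradiction (≤-trans 1≤θ (≤-trans (m≤n+m _ h′) fits)) λ ()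

-- r is the number of picks that can still occur before h falls to 2 ^ L.
greedy-bound′ : ∀ {k h p} L r → Greedy k h p →
                k * h ≤ (k + r) * 2 ^ L → p ≤ r + k * suc L
greedy-bound′ L r stop _ = z≤n
greedy-bound′ {k} {h} L r tr@(pick {h′ = h′} {θ} {p} 1≤θ h≤kθ fits rest) kh≤
  with h ≤? 2 ^ L
... | yes h≤ = halve L h≤
  where
  open ≤-Reasoning
  θ≤h : θ ≤ h
  θ≤h = ≤-trans (m≤n+m θ h′) fits
  1≤k : 1 ≤ k
  1≤k = n≢0⇒n>0 λ { refl → contradiction (≤-trans 1≤θ (≤-trans θ≤h h≤kθ)) λ () }
  double : ∀ x → k * (2 * x) ≡ (k + k) * x
  double x = trans (sym (*-assoc k 2 x))
               (cong (_* x) (trans (*-comm k 2) (cong (k +_) (+-identityʳ k))))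
  -- Once `h ≤ 2 ^ L`, the exponent drops by one and `k` fresh picks are granted, because
  -- `k * 2 ^ suc L` is `(k + k) * 2 ^ L`. At exponent 0 the present pick leaves nothing to cover,
  -- and `1 ≤ k` pays for it.
  halve : ∀ L → h ≤ 2 ^ L → suc p ≤ r + k * suc L
  halve zero h≤1 = begin
    suc p      ≡⟨ cong suc (greedy-empty (subst (λ g → Greedy k g p) h′≡0 rest)) ⟩
    1          ≤⟨ 1≤k ⟩
    k          ≡⟨ sym (*-identityʳ k) ⟩
    k * 1      ≤⟨ m≤n+m _ r ⟩
    r + k * 1  ∎
    where
    h′≡0 : h′ ≡ 0
    h′≡0 = n≤0⇒n≡0 (+-cancelʳ-≤ 1 h′ 0
             (≤-trans (+-monoʳ-≤ h′ 1≤θ) (≤-trans fits h≤1)))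
  halve (suc L) h≤ = begin
    suc p                ≤⟨ greedy-bound′ L k tr (≤-trans (*-monoʳ-≤ k h≤) (≤-reflexive (double (2 ^ L)))) ⟩
    k + k * suc L        ≡⟨ sym (*-suc k (suc L)) ⟩
    k * suc (suc L)      ≤⟨ m≤n+m _ r ⟩
    r + k * suc (suc L)  ∎
... | no h≰ = spend r kh≤
  where
  open ≤-Reasoning
  -- Here `k * θ ≥ h > 2 ^ L`, so the pick lowers `k * h` by at least `2 ^ L` and is charged to one
  -- unit of `r`. With no unit left, the invariant would force `h ≤ 2 ^ L`.
  spend : ∀ r → k * h ≤ (k + r) * 2 ^ L → suc p ≤ r + k * suc L
  spend zero kh≤ = contradiction (*-cancelˡ-≤ k {{k≢0}} (begin
    k * h            ≤⟨ kh≤ ⟩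
    (k + 0) * 2 ^ L  ≡⟨ cong (_* 2 ^ L) (+-identityʳ k) ⟩
    k * 2 ^ L        ∎)) h≰
    where
    k≢0 : NonZero k
    k≢0 = ≢-nonZero λ { refl →
      contradiction (≤-trans 1≤θ (≤-trans (m≤n+m θ h′) (≤-trans fits h≤kθ))) λ () }
  spend (suc r) kh≤ = s≤s (greedy-bound′ L r rest (+-cancelʳ-≤ (2 ^ L) _ _ (begin
    k * h′ + 2 ^ L           ≤⟨ +-monoʳ-≤ (k * h′) (≤-trans (≰⇒≥ h≰) h≤kθ) ⟩
    k * h′ + k * θ           ≡⟨ sym (*-distribˡ-+ k h′ θ) ⟩
    k * (h′ + θ)             ≤⟨ *-monoʳ-≤ k fits ⟩
    k * h                    ≤⟨ kh≤ ⟩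
    (k + suc r) * 2 ^ L      ≡⟨ cong (_* 2 ^ L) (+-suc k r) ⟩
    suc (k + r) * 2 ^ L      ≡⟨ +-comm (2 ^ L) _ ⟩
    (k + r) * 2 ^ L + 2 ^ L  ∎)))

greedy-bound : ∀ {k h p} L → Greedy k h p → h ≤ 2 ^ L → p ≤ k * suc L
greedy-bound {k} L tr h≤ = greedy-bound′ L 0 tr
  (≤-trans (*-monoʳ-≤ k h≤) (≤-reflexive (cong (_* 2 ^ L) (sym (+-identityʳ k)))))

n<2^[1+⌊log₂n⌋] : ∀ n → n < 2 ^ suc ⌊log₂ n ⌋
n<2^[1+⌊log₂n⌋] n = ≰⇒> λ 2^≤n →
  1+n≰n (subst (_≤ ⌊log₂ n ⌋) (⌊log₂[2^n]⌋≡n (suc ⌊log₂ n ⌋)) (⌊log₂⌋-mono-≤ 2^≤n))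

-- Counting

count : (A → Bool) → List A → ℕ
count f xs = length (filterᵇ f xs)

count-∨ : ∀ (f g : A → Bool) xs → count (λ x → f x ∨ g x) xs ≤ count f xs + count g xs
count-∨ f g [] = z≤n
count-∨ f g (x ∷ xs) with f x | g x
... | true  | true  = s≤s (≤-trans (count-∨ f g xs) (+-monoʳ-≤ (count f xs) (n≤1+n _)))
... | true  | false = s≤s (count-∨ f g xs)
... | false | true  = ≤-trans (s≤s (count-∨ f g xs)) (≤-reflexive (sym (+-suc (count f xs) _)))
... | false | false = count-∨ f g xs

count-ʳ++ : ∀ (f : A → Bool) xs {ys} → count f (xs ʳ++ ys) ≡ count f xs + count f ys
count-ʳ++ f [] = refl
count-ʳ++ f (x ∷ xs) {ys} with ih ← count-ʳ++ f xs {x ∷ ys} | f x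
... | true  = trans ih (+-suc (count f xs) _)
... | false = ih

count-false : ∀ (f : A → Bool) xs → (∀ x → f x ≡ false) → count f xs ≡ 0
count-false f [] _ = refl
count-false f (x ∷ xs) none with f x in fx
... | true  = contradiction (trans (sym fx) (none x)) λ ()
... | false = count-false f xs none

count≡0⇒false : ∀ (f : A → Bool) xs → count f xs ≡ 0 → All (λ x → f x ≡ false) xs
count≡0⇒false f [] _ = []
count≡0⇒false f (x ∷ xs) c≡0 with f x in fx
... | false = fx ∷ count≡0⇒false f xs c≡0

filterᵇ⁺ : ∀ (f : A → Bool) {P : A → Set} {xs} → All P xs → All P (filterᵇ f xs)
filterᵇ⁺ f [] = []
filterᵇ⁺ f {xs = x ∷ _} (px ∷ pxs) with f x
... | true  = px ∷ filterᵇ⁺ f pxs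
... | false = filterᵇ⁺ f pxs

ʳ++⁺ : ∀ {P : A → Set} {xs ys} → All P xs → All P ys → All P (xs ʳ++ ys)
ʳ++⁺ []         pys = pys
ʳ++⁺ (px ∷ pxs) pys = ʳ++⁺ pxs (px ∷ pys)

ʳ++⁻ : ∀ {P : A → Set} xs {ys} → All P (xs ʳ++ ys) → All P xs × All P ys
ʳ++⁻ []       pys = [] , pys
ʳ++⁻ (x ∷ xs) p   with ʳ++⁻ xs p
... | pxs , px ∷ pys = px ∷ pxs , pys

toList⁺ : ∀ {P : A → Set} (v : Vec A l) → (∀ i → P (lookup v i)) → All P (toList v)
toList⁺ []      _  = []
toList⁺ (x ∷ v) pv = pv zero ∷ toList⁺ v (pv ∘ suc)

length-cartesianProduct : ∀ (xs ys : List A) →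
                          length (cartesianProduct xs ys) ≡ length xs * length ys
length-cartesianProduct []       ys = refl
length-cartesianProduct (x ∷ xs) ys = trans (length-++ (map (x ,_) ys))
  (cong₂ _+_ (length-map (x ,_) ys) (length-cartesianProduct xs ys))

-- Separating positions

Pair : ℕ → Set
Pair m = Subset m × Subset m

-- The default `false` beyond the end agrees with the program, where `hd` and `tl` of `nil` are
-- `nil`, the code of `false`.
bit : ℕ → Vec Bool l → Bool
bit p       []       = false
bit zero    (b ∷ bs) = b
bit (suc p) (b ∷ bs) = bit p bs

bit-toℕ : ∀ (v : Vec Bool l) x → bit (toℕ x) v ≡ lookup v x
bit-toℕ (b ∷ v) zero    = refl
bit-toℕ (b ∷ v) (suc x) = bit-toℕ v x

bit-≥ : ∀ {p} (v : Vec Bool l) → l ≤ p → bit p v ≡ false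
bit-≥ []                   _         = refl
bit-≥ {p = suc p} (b ∷ v) (s≤s l≤p) = bit-≥ v l≤p

bit⇒Fin : ∀ p (v : Vec Bool l) → bit p v ≡ true → ∃ λ (x : Fin l) → toℕ x ≡ p
bit⇒Fin zero    (b ∷ v) _  = zero , refl
bit⇒Fin (suc p) (b ∷ v) eq with bit⇒Fin p v eq
... | x , refl = suc x , refl

separates : ℕ → Pair l → Bool
separates p (s , t) = bit p s ∧ not (bit p t)

-- The first entry of the vector stands for position p.
hitsFrom : ℕ → Vec Bool r → Pair l → Bool
hitsFrom p []       w = false
hitsFrom p (b ∷ bs) w = (b ∧ separates p w) ∨ hitsFrom (suc p) bs w

hitsFrom⁺ : ∀ {w : Pair l} p (X : Vec Bool r) x → lookup X x ≡ true →
            separates (p + toℕ x) w ≡ true → hitsFrom p X w ≡ true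
hitsFrom⁺ {w = w} p (b ∷ X) zero refl sep
  rewrite +-identityʳ p | sep = refl
hitsFrom⁺ {w = w} p (b ∷ X) (suc x) x∈X sep
  with b ∧ separates p w
... | true  = refl
... | false = hitsFrom⁺ (suc p) X x x∈X (subst (λ q → separates q w ≡ true) (+-suc p (toℕ x)) sep)

hitsFrom⁻ : ∀ {w : Pair l} p (X : Vec Bool r) → hitsFrom p X w ≡ true →
            ∃ λ x → lookup X x ≡ true × separates (p + toℕ x) w ≡ true
hitsFrom⁻ {w = w} p (b ∷ X) hit with b in b≡ | separates p w in sep
... | true  | true  = zero , refl , trans (cong (λ q → separates q w) (+-identityʳ p)) sep
... | true  | false with hitsFrom⁻ (suc p) X hit
...   | x , x∈X , s = suc x , x∈X , subst (λ q → separates q w ≡ true) (sym (+-suc p (toℕ x))) s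
hitsFrom⁻ {w = w} p (b ∷ X) hit | false | _ with hitsFrom⁻ (suc p) X hit
...   | x , x∈X , s = suc x , x∈X , subst (λ q → separates q w ≡ true) (sym (+-suc p (toℕ x))) s

-- A union bound over the elements of `Y`. It gives the condition `h ≤ k * θ` of a greedy pick.
count-hitsFrom : ∀ {τ} p (Y : Subset r) (W : List (Pair l)) →
                 (∀ q → count (separates q) W ≤ τ) →
                 count (hitsFrom p Y) W ≤ ∣ Y ∣ * τ
count-hitsFrom p [] W le = ≤-reflexive (count-false _ W λ _ → refl)
count-hitsFrom p (true ∷ Y) W le =
  ≤-trans (count-∨ (separates p) (hitsFrom (suc p) Y) W)
    (+-mono-≤ (le p) (count-hitsFrom (suc p) Y W le))
count-hitsFrom p (false ∷ Y) W le = count-hitsFrom (suc p) Y W le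

-- The premise exempts the pairs with `s ⊆ t`, which no position can separate, so that all ordered
-- pairs can be treated alike.
Hits : Subset l → Pair l → Set
Hits Y w = ∀ q → separates q w ≡ true → hitsFrom 0 Y w ≡ true

-- The threshold algorithm

-- Reversed, as a loop that pushes onto an accumulator produces it.
unseparated : ℕ → List (Pair l) → List (Pair l)
unseparated p W = filterᵇ (not ∘ separates p) W ʳ++ []

unseparated⁺ : ∀ p {P : Pair l → Set} {W} → All P W → All P (unseparated p W)
unseparated⁺ p pW = ʳ++⁺ (filterᵇ⁺ (not ∘ separates p) pW) []

unseparated⁻ : ∀ p {P : Pair l → Set} W → All P (unseparated p W) →
               (∀ w → separates p w ≡ true → P w) → All P W
unseparated⁻ p {P} W pW sep⇒P = go W (proj₁ (ʳ++⁻ (filterᵇ (not ∘ separates p) W) pW))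
  where
  go : ∀ W → All P (filterᵇ (not ∘ separates p) W) → All P W
  go []      _  = []
  go (w ∷ W) pW with separates p w in sep
  go (w ∷ W) pW        | true  = sep⇒P w sep ∷ go W pW
  go (w ∷ W) (pw ∷ pW) | false = pw ∷ go W pW

length-unseparated : ∀ p (W : List (Pair l)) → length (unseparated p W) ≤ length W
length-unseparated p W = begin
  length (unseparated p W)                        ≡⟨ length-ʳ++ (filterᵇ (not ∘ separates p) W) ⟩
  length (filterᵇ (not ∘ separates p) W) + 0      ≡⟨ +-identityʳ _ ⟩
  length (filterᵇ (not ∘ separates p) W)          ≤⟨ length-filter _ W ⟩
  length W                                        ∎
  where open ≤-Reasoning

count-unseparated : ∀ p (f : Pair l → Bool) W →
  count f (unseparated p W) ≡ count f (filterᵇ (not ∘ separates p) W)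
count-unseparated p f W = trans (count-ʳ++ f (filterᵇ (not ∘ separates p) W)) (+-identityʳ _)

count-filterᵇ-≤ : ∀ (f g : A → Bool) xs → count f (filterᵇ g xs) ≤ count f xs
count-filterᵇ-≤ f g [] = z≤n
count-filterᵇ-≤ f g (x ∷ xs) with g x
... | false with f x
...   | true  = m≤n⇒m≤1+n (count-filterᵇ-≤ f g xs)
...   | false = count-filterᵇ-≤ f g xs
count-filterᵇ-≤ f g (x ∷ xs) | true with f x
...   | true  = s≤s (count-filterᵇ-≤ f g xs)
...   | false = count-filterᵇ-≤ f g xs

count-unseparated-≤ : ∀ p (f : Pair l → Bool) W → count f (unseparated p W) ≤ count f W
count-unseparated-≤ p f W =
  ≤-trans (≤-reflexive (count-unseparated p f W)) (count-filterᵇ-≤ f _ W)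

count-unseparated-self : ∀ p (W : List (Pair l)) →
                         count (separates p) (unseparated p W) ≡ 0
count-unseparated-self p W = trans (count-unseparated p (separates p) W) (go W)
  where
  go : ∀ W → count (separates p) (filterᵇ (not ∘ separates p) W) ≡ 0
  go [] = refl
  go (w ∷ W) with separates p w in sep
  ... | true  = go W
  ... | false rewrite sep = go W

-- Used with `f` the pairs separated by the picked position and `g` those hit by an optimal `Y`:
-- everything the pick removes also counts towards `h`, which gives `h′ + θ ≤ h`.
count-split : ∀ (f g : A → Bool) {xs} → All (λ x → f x ≡ true → g x ≡ true) xs →
              count g (filterᵇ (not ∘ f) xs) + count f xs ≤ count g xs
count-split f g [] = z≤n
count-split f g {x ∷ xs} (f⇒g ∷ pxs) with ih ← count-split f g pxs | f x
... | true rewrite f⇒g refl = ≤-trans (≤-reflexive (+-suc _ _)) (s≤s ih)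
... | false with g x
...   | true  = s≤s ih
...   | false = ih

pass : ℕ → ℕ → Vec Bool r → List (Pair l) → Vec Bool r × List (Pair l)
pass θ p []       W = [] , W
pass θ p (b ∷ bs) W with θ ≤? count (separates p) W
... | yes _ = map₁ (true ∷_) (pass θ (suc p) bs (unseparated p W))
... | no  _ = map₁ (b ∷_) (pass θ (suc p) bs W)

sweep : ℕ → Subset l → List (Pair l) → Subset l × List (Pair l)
sweep zero    X W = X , W
sweep (suc τ) X W = let X′ , W′ = pass (suc τ) 0 X W in sweep τ X′ W′

pass⁺ : ∀ {θ} p (bs : Vec Bool r) {W : List (Pair l)} {P : Pair l → Set} →
         All P W → All P (proj₂ (pass θ p bs W))
pass⁺ p [] pW = pW
pass⁺ {θ = θ} p (b ∷ bs) {W} pW with θ ≤? count (separates p) W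
... | yes _ = pass⁺ (suc p) bs (unseparated⁺ p pW)
... | no  _ = pass⁺ (suc p) bs pW

pass-length : ∀ {θ} p (bs : Vec Bool r) (W : List (Pair l)) →
              length (proj₂ (pass θ p bs W)) ≤ length W
pass-length p [] W = ≤-refl
pass-length {θ = θ} p (b ∷ bs) W with θ ≤? count (separates p) W
... | yes _ = ≤-trans (pass-length (suc p) bs (unseparated p W)) (length-unseparated p W)
... | no  _ = pass-length (suc p) bs W

pass-count-≤ : ∀ {θ} p (bs : Vec Bool r) (W : List (Pair l)) (f : Pair l → Bool) →
               count f (proj₂ (pass θ p bs W)) ≤ count f W
pass-count-≤ p [] W f = ≤-refl
pass-count-≤ {θ = θ} p (b ∷ bs) W f with θ ≤? count (separates p) W
... | yes _ = ≤-trans (pass-count-≤ (suc p) bs (unseparated p W) f) (count-unseparated-≤ p f W)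
... | no  _ = pass-count-≤ (suc p) bs W f

-- When the pass reaches `q`, either `q` is picked and its count falls to 0, or it is rejected for
-- having a count of at most `τ`. Afterwards the list of pairs only shrinks.
pass-count-< : ∀ {τ q} p (bs : Vec Bool r) (W : List (Pair l)) → p ≤ q → q < p + r →
               count (separates q) (proj₂ (pass (suc τ) p bs W)) ≤ τ
pass-count-< p [] W p≤q q<p = contradiction q<p (≤⇒≯ (≤-trans (≤-reflexive (+-identityʳ p)) p≤q))
pass-count-< {τ = τ} {q} p (b ∷ bs) W p≤q q<p+r
  with suc τ ≤? count (separates p) W | m≤n⇒m<n∨m≡n p≤q
... | yes _ | inj₁ p<q = pass-count-< (suc p) bs _ p<q (≤-trans q<p+r (≤-reflexive (+-suc p _)))
... | no  _ | inj₁ p<q = pass-count-< (suc p) bs _ p<q (≤-trans q<p+r (≤-reflexive (+-suc p _)))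
... | yes _ | inj₂ refl = ≤-trans (pass-count-≤ (suc p) bs _ (separates p))
                            (≤-trans (≤-reflexive (count-unseparated-self p W)) z≤n)
... | no τ≮ | inj₂ refl = ≤-trans (pass-count-≤ (suc p) bs W (separates p)) (≮⇒≥ τ≮)

pass-hits-mono : ∀ {θ} p (bs : Vec Bool r) (W : List (Pair l)) (w : Pair l) → hitsFrom p bs w ≡ true →
                 hitsFrom p (proj₁ (pass θ p bs W)) w ≡ true
pass-hits-mono {θ = θ} p (b ∷ bs) W w hit with θ ≤? count (separates p) W
pass-hits-mono {θ = θ} p (b ∷ bs) W w hit | yes _ with b | separates p w
... | _     | true  = refl
... | true  | false = pass-hits-mono (suc p) bs _ w hit
... | false | false = pass-hits-mono (suc p) bs _ w hit
pass-hits-mono {θ = θ} p (b ∷ bs) W w hit | no _ with b ∧ separates p w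
... | true  = refl
... | false = pass-hits-mono (suc p) bs W w hit

∨-left : ∀ {x y} → x ≡ true → x ∨ y ≡ true
∨-left refl = refl

∨-right : ∀ {x y} → y ≡ true → x ∨ y ≡ true
∨-right {true}  _ = refl
∨-right {false} e = e

-- A pair is dropped only when a position separating it is picked, and that position belongs to
-- `bs′`.
pass-cover : ∀ {θ} p (bs : Vec Bool r) (W : List (Pair l)) {P : Pair l → Set} →
             let bs′ , W′ = pass θ p bs W in
             All P W′ → (∀ (w : Pair l) → hitsFrom p bs′ w ≡ true → P w) → All P W
pass-cover p [] W pW′ _ = pW′
pass-cover {θ = θ} p (b ∷ bs) W pW′ hit⇒P with θ ≤? count (separates p) W
... | yes _ = unseparated⁻ p W
      (pass-cover (suc p) bs _ pW′ λ w hit → hit⇒P w (∨-right hit))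
      λ w sep → hit⇒P w (∨-left sep)
... | no  _ = pass-cover (suc p) bs W pW′ λ w hit → hit⇒P w (∨-right hit)

-- The trace is built from the back: `tr` records the picks of later passes, and those of this pass
-- are put in front of it. As no count exceeds `suc τ`, every position that meets the threshold is a
-- greedy choice.
pass-greedy : ∀ {τ u} p (bs : Subset r) (W : List (Pair l)) (Y : Subset l) →
  All (Hits Y) W → (∀ q → count (separates q) W ≤ suc τ) →
  let bs′ , W′ = pass (suc τ) p bs W in
  Greedy ∣ Y ∣ (count (hitsFrom 0 Y) W′) u →
  ∃ λ v → Greedy ∣ Y ∣ (count (hitsFrom 0 Y) W) (v + u) × ∣ bs′ ∣ ≤ v + ∣ bs ∣
pass-greedy p [] W Y hits le tr = 0 , tr , z≤n
pass-greedy {τ = τ} p (b ∷ bs) W Y hits le tr with suc τ ≤? count (separates p) W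
... | yes τ<c with pass-greedy (suc p) bs (unseparated p W) Y (unseparated⁺ p hits)
                     (λ q → ≤-trans (count-unseparated-≤ p (separates q) W) (le q)) tr
...   | v , tr′ , v≤ = suc v , pick (≤-trans (s≤s z≤n) τ<c)
          (≤-trans (count-hitsFrom 0 Y W le) (*-monoʳ-≤ ∣ Y ∣ τ<c))
          (≤-trans (≤-reflexive (cong (_+ count (separates p) W) (count-unseparated p (hitsFrom 0 Y) W)))
            (count-split (separates p) (hitsFrom 0 Y) (All.map (λ hit → hit p) hits)))
          tr′ ,
        -- The old bit is not inspected: charging the pick as a new element is safe even if `b` was
        -- already `true`.
        s≤s (≤-trans v≤ (+-monoʳ-≤ v (∣p∣≤∣x∷p∣ b bs)))
pass-greedy {τ = τ} p (b ∷ bs) W Y hits le tr | no _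
  with pass-greedy (suc p) bs W Y hits le tr
... | v , tr′ , v≤ = v , tr′ , cons-≤ b
  where
  cons-≤ : ∀ b → ∣ b ∷ proj₁ (pass (suc τ) (suc p) bs W) ∣ ≤ v + ∣ b ∷ bs ∣
  cons-≤ true  = ≤-trans (s≤s v≤) (≤-reflexive (sym (+-suc v _)))
  cons-≤ false = v≤

-- Positions inside the range are covered by `pass-count-<`; those beyond it separate nothing. This
-- is the invariant with which the next, lower threshold starts.
pass-count : ∀ {τ} (X : Subset l) (W : List (Pair l)) q →
             count (separates q) (proj₂ (pass (suc τ) 0 X W)) ≤ τ
pass-count {l = l} X W q with q <? l
... | yes q<l = pass-count-< 0 X W z≤n q<l
... | no  q≮l = ≤-trans (≤-reflexive (count-false (separates q) (proj₂ (pass _ 0 X W))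
                  λ (s , t) → cong (_∧ not (bit q t)) (bit-≥ s (≮⇒≥ q≮l)))) z≤n

sweep-hits-mono : ∀ τ (X : Subset l) (W : List (Pair l)) (w : Pair l) → hitsFrom 0 X w ≡ true →
                  hitsFrom 0 (proj₁ (sweep τ X W)) w ≡ true
sweep-hits-mono zero    X W w hit = hit
sweep-hits-mono (suc τ) X W w hit =
  sweep-hits-mono τ _ _ w (pass-hits-mono 0 X W w hit)

sweep-hits : ∀ τ (X : Subset l) (W : List (Pair l)) →
             (∀ q → count (separates q) W ≤ τ) → All (Hits (proj₁ (sweep τ X W))) W
sweep-hits zero X W le = All.tabulate λ w∈W q sep →
  -- At threshold 0 no remaining pair is separated by any position, so the premise of `Hits` is
  -- absurd.
  contradiction
    (trans (sym sep) (All.lookup (count≡0⇒false (separates q) W (n≤0⇒n≡0 (le q))) w∈W)) λ ()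
sweep-hits (suc τ) X W le =
  pass-cover 0 X W (sweep-hits τ _ _ (pass-count X W))
    λ w hit _ _ → sweep-hits-mono τ _ _ w hit

sweep-greedy : ∀ τ (X : Subset l) (W : List (Pair l)) (Y : Subset l) →
  All (Hits Y) W → (∀ q → count (separates q) W ≤ τ) →
  ∃ λ v → Greedy ∣ Y ∣ (count (hitsFrom 0 Y) W) v × ∣ proj₁ (sweep τ X W) ∣ ≤ v + ∣ X ∣
sweep-greedy zero X W Y hits le = 0 , stop , ≤-refl
sweep-greedy (suc τ) X W Y hits le
  with sweep-greedy τ _ _ Y (pass⁺ 0 X hits) (pass-count X W)
... | u , tr , u≤ with pass-greedy 0 X W Y hits le tr
...   | v , tr′ , v≤ = v + u , tr′ , (begin
          _                ≤⟨ u≤ ⟩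
          u + _            ≤⟨ +-monoʳ-≤ u v≤ ⟩
          u + (v + ∣ X ∣)  ≡⟨ sym (+-assoc u v _) ⟩
          u + v + ∣ X ∣    ≡⟨ cong (_+ ∣ X ∣) (+-comm u v) ⟩
          v + u + ∣ X ∣    ∎)
  where open ≤-Reasoning

-- Compare sets

separates⁺ : ∀ {s t : Subset l} {x} → x ∈ s → x ∉ t → separates (toℕ x) (s , t) ≡ true
separates⁺ {s = s} {t} {x} x∈s x∉t
  rewrite bit-toℕ s x | bit-toℕ t x | []=⇒lookup x∈s with lookup t x in tx
... | true  = contradiction (lookup⇒[]= x t tx) x∉t
... | false = refl

separates⁻ : ∀ {s t : Subset l} q → separates q (s , t) ≡ true →
             ∃ λ x → toℕ x ≡ q × x ∈ s × x ∉ t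
separates⁻ {s = s} {t} q sep with bit q s in qs | bit q t in qt
... | true | false with bit⇒Fin q s qs
...   | x , refl = x , refl , lookup⇒[]= x s (trans (sym (bit-toℕ s x)) qs) ,
        λ x∈t → contradiction (trans (sym qt) (trans (bit-toℕ t x) ([]=⇒lookup x∈t))) λ ()

module _ (I : Instance) where

  private
    b : Fin (n I) → Subset (m I)
    b = lookup (B I)

  -- If no position in `Y` separated the pair, `b i ∩ Y` would lie in `b j ∩ Y`, and the compare
  -- property would give `b i ⊆ b j`, against the position `q`.
  compare⇒hits : ∀ Y → IsCompareSet I Y → ∀ i j → Hits Y (b i , b j)
  compare⇒hits Y compare i j q sep with hitsFrom 0 Y (b i , b j) in hit
  ... | true  = refl
  ... | false with separates⁻ q sep
  ...   | x , _ , x∈bᵢ , x∉bⱼ = contradiction (Equivalence.from (compare i j) restricted x∈bᵢ) x∉bⱼ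
    where
    restricted : (b i ∩ Y) ⊆ (b j ∩ Y)
    restricted {y} y∈ with x∈p∩q⁻ (b i) Y y∈
    ... | y∈bᵢ , y∈Y with y ∈? b j
    ...   | yes y∈bⱼ = x∈p∩q⁺ (y∈bⱼ , y∈Y)
    ...   | no  y∉bⱼ = contradiction
              (trans (sym hit) (hitsFrom⁺ 0 Y y ([]=⇒lookup y∈Y) (separates⁺ y∈bᵢ y∉bⱼ))) λ ()

  -- Restriction preserves inclusion for every `X`. Conversely, an `x` in `b i` but not in `b j`
  -- yields a separating position inside `X`, which refutes the inclusion of the restrictions.
  hits⇒compare : ∀ X → (∀ i j → Hits X (b i , b j)) → IsCompareSet I X
  hits⇒compare X hits i j = mk⇔ preserves reflects
    where
    preserves : b i ⊆ b j → (b i ∩ X) ⊆ (b j ∩ X)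
    preserves bᵢ⊆bⱼ y∈ with x∈p∩q⁻ (b i) X y∈
    ... | y∈bᵢ , y∈X = x∈p∩q⁺ (bᵢ⊆bⱼ y∈bᵢ , y∈X)
    reflects : (b i ∩ X) ⊆ (b j ∩ X) → b i ⊆ b j
    reflects sub {x} x∈bᵢ with x ∈? b j
    ... | yes x∈bⱼ = x∈bⱼ
    ... | no  x∉bⱼ
      with hitsFrom⁻ 0 X (hits i j (toℕ x) (separates⁺ x∈bᵢ x∉bⱼ))
    ...   | y , y∈X , sep with separates⁻ (toℕ y) sep
    ...     | z , z≡y , z∈bᵢ , z∉bⱼ rewrite toℕ-injective z≡y =
      contradiction
        (proj₁ (x∈p∩q⁻ (b j) X (sub (x∈p∩q⁺ (z∈bᵢ , lookup⇒[]= y X y∈X))))) z∉bⱼ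

  pairs : List (Pair (m I))
  pairs = cartesianProduct (toList (B I)) (toList (B I)) ʳ++ []

  pairs⁺ : ∀ {P : Pair (m I) → Set} → (∀ i j → P (b i , b j)) → All P pairs
  pairs⁺ {P} all = ʳ++⁺ (All.tabulate member) []
    where
    rows : All (λ s → All (λ t → P (s , t)) (toList (B I))) (toList (B I))
    rows = toList⁺ (B I) λ i → toList⁺ {P = λ t → P (b i , t)} (B I) (all i)
    member : ∀ {w} → w ∈ₗ cartesianProduct (toList (B I)) (toList (B I)) → P w
    member w∈ with ∈-cartesianProduct⁻ (toList (B I)) (toList (B I)) w∈
    ... | s∈ , t∈ = All.lookup (All.lookup rows s∈) t∈

  pairs⁻ : ∀ {P : Pair (m I) → Set} → All P pairs → ∀ i j → P (b i , b j)
  pairs⁻ all i j = All.lookup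
    (proj₁ (ʳ++⁻ (cartesianProduct (toList (B I)) (toList (B I))) all))
    (∈-cartesianProduct⁺ (∈-toList⁺ (∈-lookup i (B I))) (∈-toList⁺ (∈-lookup j (B I))))

  length-pairs : length pairs ≡ n I * n I
  length-pairs = begin
    length pairs                                 ≡⟨ length-ʳ++ (cartesianProduct Bs Bs) ⟩
    length (cartesianProduct Bs Bs) + 0          ≡⟨ +-identityʳ _ ⟩
    length (cartesianProduct Bs Bs)              ≡⟨ length-cartesianProduct Bs Bs ⟩
    length Bs * length Bs                        ≡⟨ cong₂ _*_ (length-toList (B I)) (length-toList (B I)) ⟩
    n I * n I                                    ∎
    where
    open ≡-Reasoning
    Bs = toList (B I)

  approx : Subset (m I)
  approx = proj₁ (sweep (length pairs) ⊥ pairs)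

  pairs-count : ∀ q → count (separates q) pairs ≤ length pairs
  pairs-count q = length-filter _ pairs

  approx-compare : IsCompareSet I approx
  approx-compare = hits⇒compare approx
    (pairs⁻ (sweep-hits (length pairs) ⊥ pairs pairs-count))

  -- For `n I ≤ 1` the logarithm is 0, so the approximation bound can hold only because the optimum
  -- is empty.
  ⊥-compare : n I ≤ 1 → IsCompareSet I ⊥
  ⊥-compare n≤1 i j = subst (λ j → (b i ⊆ b j) ⇔ ((b i ∩ ⊥) ⊆ (b j ∩ ⊥))) (i≡j n≤1 i j)
    (mk⇔ {A = b i ⊆ b i} {B = (b i ∩ ⊥) ⊆ (b i ∩ ⊥)} (λ _ → id) (λ _ → id))
    where
    i≡j : ∀ {n} → n ≤ 1 → (i j : Fin n) → i ≡ j
    i≡j (s≤s z≤n) zero zero = refl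

  approx-bound : ∀ Y → IsMinimumCompareSet I Y → ∣ approx ∣ ≤ 5 * ⌊log₂ n I ⌋ * ∣ Y ∣
  approx-bound Y (compare , minimum)
    with sweep-greedy (length pairs) ⊥ pairs Y (pairs⁺ (compare⇒hits Y compare)) pairs-count
  ... | p , tr , ≤p = begin
    ∣ approx ∣                ≤⟨ ≤p ⟩
    p + ∣ ⊥ {n = m I} ∣        ≡⟨ cong (p +_) (∣⊥∣≡0 (m I)) ⟩
    p + 0                     ≡⟨ +-identityʳ p ⟩
    -- There are `n²` pairs and `n ≤ 2 ^ suc L`, so the exponent is twice `suc L`.
    p                         ≤⟨ greedy-bound (suc L + suc L) tr count≤ ⟩
    ∣ Y ∣ * suc (suc L + suc L)  ≤⟨ factor (n I ≤? 1) ⟩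
    ∣ Y ∣ * (5 * L)            ≡⟨ *-comm ∣ Y ∣ _ ⟩
    5 * L * ∣ Y ∣              ∎
    where
    open ≤-Reasoning
    L = ⌊log₂ n I ⌋
    n≤ : n I ≤ 2 ^ suc L
    n≤ = <⇒≤ (n<2^[1+⌊log₂n⌋] (n I))
    count≤ : count (hitsFrom 0 Y) pairs ≤ 2 ^ (suc L + suc L)
    count≤ = begin
      count (hitsFrom 0 Y) pairs  ≤⟨ length-filter _ pairs ⟩
      length pairs                ≡⟨ length-pairs ⟩
      n I * n I                   ≤⟨ *-mono-≤ n≤ n≤ ⟩
      2 ^ suc L * 2 ^ suc L       ≡⟨ sym (^-distribˡ-+-* 2 (suc L) (suc L)) ⟩
      2 ^ (suc L + suc L)         ∎
    factor : Dec (n I ≤ 1) → ∣ Y ∣ * suc (suc L + suc L) ≤ ∣ Y ∣ * (5 * L)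
    factor (yes n≤1) = ≤-trans (≤-reflexive (cong (_* suc (suc L + suc L)) Y≡∅)) z≤n
      where
      Y≡∅ : ∣ Y ∣ ≡ 0
      Y≡∅ = n≤0⇒n≡0 (≤-trans (minimum ⊥ (⊥-compare n≤1)) (≤-reflexive (∣⊥∣≡0 (m I))))
    -- The constant 5 arises from `2 * L + 3 ≤ 5 * L`, valid since `1 ≤ L` for `n I ≥ 2`.
    factor (no n≰1) = *-monoʳ-≤ ∣ Y ∣ (begin
      1 + (suc L + suc L)      ≤⟨ +-mono-≤ 1≤L (+-mono-≤ 1+L≤ 1+L≤) ⟩
      L + ((L + L) + (L + L))  ≡⟨ five L ⟩
      5 * L                    ∎)
      where
      1≤L : 1 ≤ L
      1≤L = ⌊log₂⌋-mono-≤ (≰⇒> n≰1)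
      1+L≤ : suc L ≤ L + L
      1+L≤ = +-monoˡ-≤ L 1≤L
      five : ∀ x → x + ((x + x) + (x + x)) ≡ 5 * x
      five = solve-∀

-- Polynomial bounds

-- Sizes of trees are positive. At `s = 0` raising the exponent, on which `poly-+` relies, could
-- decrease the power.
PolyBounded : (ℕ → ℕ) → Set
PolyBounded f = ∃₂ λ a d → ∀ s → 1 ≤ s → f s ≤ a * s ^ d

poly-const : ∀ c → PolyBounded (λ _ → c)
poly-const c = c , 0 , λ s _ → ≤-reflexive (sym (*-identityʳ c))

poly-id : PolyBounded (λ s → s)
poly-id = 1 , 1 , λ s _ → ≤-reflexive (trans (sym (*-identityʳ s)) (sym (*-identityˡ (s * 1))))

poly-+ : ∀ {f g} → PolyBounded f → PolyBounded g → PolyBounded (λ s → f s + g s)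
poly-+ {f} {g} (a , d , f≤) (b , e , g≤) = a + b , d + e , λ s 1≤s → begin
  f s + g s                          ≤⟨ +-mono-≤ (f≤ s 1≤s) (g≤ s 1≤s) ⟩
  a * s ^ d + b * s ^ e              ≤⟨ +-mono-≤ (*-monoʳ-≤ a (pow s 1≤s (m≤m+n d e)))
                                                 (*-monoʳ-≤ b (pow s 1≤s (m≤n+m e d))) ⟩
  a * s ^ (d + e) + b * s ^ (d + e)  ≡⟨ sym (*-distribʳ-+ (s ^ (d + e)) a b) ⟩
  (a + b) * s ^ (d + e)              ∎
  where
  open ≤-Reasoning
  pow : ∀ s → 1 ≤ s → ∀ {i j} → i ≤ j → s ^ i ≤ s ^ j
  pow s 1≤s = ^-monoʳ-≤ s {{>-nonZero 1≤s}}

poly-* : ∀ {f g} → PolyBounded f → PolyBounded g → PolyBounded (λ s → f s * g s)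
poly-* {f} {g} (a , d , f≤) (b , e , g≤) = a * b , d + e , λ s 1≤s → begin
  f s * g s                  ≤⟨ *-mono-≤ (f≤ s 1≤s) (g≤ s 1≤s) ⟩
  (a * s ^ d) * (b * s ^ e)  ≡⟨ [m*n]*[o*p]≡[m*o]*[n*p] a (s ^ d) b (s ^ e) ⟩
  (a * b) * (s ^ d * s ^ e)  ≡⟨ cong (a * b *_) (sym (^-distribˡ-+-* s d e)) ⟩
  (a * b) * s ^ (d + e)      ∎
  where open ≤-Reasoning

-- Timed executions

-- An upper bound instead of the exact time lets branches and iterations of different cost share one
-- bound.
record _⊢_⇓_within_ (c : Com k) (σ σ′ : Store k) (T : ℕ) : Set where
  constructor timed
  field
    {time}    : ℕ
    in-time   : time ≤ T
    execution : Exec c σ time σ′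

open _⊢_⇓_within_

private
  variable
    c d : Com k
    e : Exp k
    x : Fin k
    σ σ′ σ₁ σ₂ σ₃ : Store k
    S T : ℕ

weaken : S ≤ T → c ⊢ σ ⇓ σ′ within S → c ⊢ σ ⇓ σ′ within T
weaken S≤T (timed t≤S run) = timed (≤-trans t≤S S≤T) run

assign! : (x := e) ⊢ σ ⇓ (σ [ x ]≔ eval e σ) within (1 + cost e)
assign! = timed ≤-refl assign

infixr 5 _then_
_then_ : c ⊢ σ₁ ⇓ σ₂ within S → d ⊢ σ₂ ⇓ σ₃ within T → (c ⨾ d) ⊢ σ₁ ⇓ σ₃ within (S + T)
timed s≤S run₁ then timed t≤T run₂ = timed (+-mono-≤ s≤S t≤T) (seq run₁ run₂)

branch-true : eval e σ ≢ nil → c ⊢ σ ⇓ σ′ within T →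
              (if e then c else d) ⊢ σ ⇓ σ′ within (1 + cost e + T)
branch-true e≢nil (timed t≤T run) = timed (+-monoʳ-≤ _ t≤T) (if-true e≢nil run)

branch-false : eval e σ ≡ nil → d ⊢ σ ⇓ σ′ within T →
               (if e then c else d) ⊢ σ ⇓ σ′ within (1 + cost e + T)
branch-false e≡nil (timed t≤T run) = timed (+-monoʳ-≤ _ t≤T) (if-false e≡nil run)

-- Opaque, so that the number of iterations and the time of the body can be
-- read off a bound by unification.
opaque
  loopBound : ℕ → ℕ → ℕ
  loopBound n T = n * (2 + T) + 2

  loop-done : lookup σ x ≡ nil → (while (var x) loop c) ⊢ σ ⇓ σ within loopBound 0 T
  loop-done x≡nil = timed ≤-refl (while-done x≡nil)

  loop-step : ∀ {n} → lookup σ₁ x ≢ nil → c ⊢ σ₁ ⇓ σ₂ within T →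
              (while (var x) loop c) ⊢ σ₂ ⇓ σ₃ within loopBound n T →
              (while (var x) loop c) ⊢ σ₁ ⇓ σ₃ within loopBound (suc n) T
  loop-step {T = T} {n = n} x≢nil (timed s≤T run) (timed t≤ rest) =
    timed (≤-trans (+-mono-≤ (+-monoʳ-≤ 2 s≤T) t≤) (≤-reflexive (sym (+-assoc (2 + T) _ 2))))
      (while-true x≢nil run rest)

  loopBound-mono : ∀ {m n S T} → m ≤ n → S ≤ T → loopBound m S ≤ loopBound n T
  loopBound-mono m≤n S≤T = +-monoˡ-≤ 2 (*-mono-≤ m≤n (+-monoʳ-≤ 2 S≤T))

  poly-loop : ∀ {f g} → PolyBounded f → PolyBounded g →
              PolyBounded (λ s → loopBound (f s) (g s))
  poly-loop pf pg = poly-+ (poly-* pf (poly-+ (poly-const 2) pg)) (poly-const 2)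

-- The program

-- Numbers are held in unary: level is a list whose length is the threshold, and
-- missing is left with as many entries as the count falls short of it.
pattern answer   = 0F
pattern sets     = 1F
pattern todo     = 2F
pattern level    = 3F
pattern position = 4F
pattern done     = 5F
pattern missing  = 6F
pattern queue    = 7F
pattern kept     = 8F
pattern offset   = 9F
pattern left     = suc 9F
pattern right    = suc (suc 9F)

advance : Com 12
advance = while (var offset) loop
  (left := tl (var left) ⨾ right := tl (var right) ⨾ offset := tl (var offset))

keep : Com 12
keep = kept := cons (hd (var queue)) (var kept)

examine : Com 12
examine =
  offset := var position ⨾ left := hd (hd (var queue)) ⨾ right := tl (hd (var queue)) ⨾
  advance ⨾
  if hd (var left)
    -- Only the inner `else` is a separated pair: it is not kept, and one entry of `missing` is
    -- struck off.
    then (if hd (var right) then keep else (missing := tl (var missing)))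
    else keep ⨾
  queue := tl (var queue)

scan : Com 12
scan = while (var queue) loop examine

visit : Com 12
visit =
  missing := var level ⨾ queue := var todo ⨾ kept := nil ⨾
  scan ⨾
  -- `missing` is `nil` exactly when the threshold is reached, so the `else` branch is the pick.
  if var missing
    then done := cons (hd (var answer)) (var done)
    else (done := cons (cons nil nil) (var done) ⨾ todo := var kept) ⨾
  answer := tl (var answer) ⨾ position := cons nil (var position)

visits : Com 12
visits = while (var answer) loop visit

restore : Com 12
restore = while (var done) loop
  (answer := cons (hd (var done)) (var answer) ⨾ done := tl (var done))

round : Com 12
round = position := nil ⨾ done := nil ⨾ visits ⨾ restore ⨾ level := tl (var level)

rounds : Com 12
rounds = while (var level) loop round

pairRow : Com 12
pairRow = while (var right) loop
  (todo := cons (cons (hd (var left)) (hd (var right))) (var todo) ⨾ right := tl (var right))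

pairRows : Com 12
pairRows = while (var left) loop
  (right := var sets ⨾ pairRow ⨾ left := tl (var left))

greedy : Com 12
greedy =
  -- The `m` copies of `nil` in the input already encode the empty subset. Later the list of pairs
  -- itself serves as the unary numeral for the initial threshold.
  sets := tl (var answer) ⨾ answer := hd (var answer) ⨾ left := var sets ⨾
  pairRows ⨾ level := var todo ⨾ rounds

-- Its correctness

encodePair : Pair l → Tree
encodePair (s , t) = cons (encodeSubset s) (encodeSubset t)

encodePairs : List (Pair l) → Tree
encodePairs W = encodeList (map encodePair W)

unary : ℕ → Tree
unary zero    = nil
unary (suc p) = cons nil (unary p)

tails : ℕ → Tree → Tree
tails zero    t = t
tails (suc p) t = tails p (tail t)

tails-nil : ∀ p → tails p nil ≡ nil
tails-nil zero    = refl
tails-nil (suc p) = tails-nil p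

head-tails : ∀ p (X : Vec Bool l) → head (tails p (encodeSubset X)) ≡ encodeBool (bit p X)
head-tails p       []      = cong head (tails-nil p)
head-tails zero    (b ∷ X) = refl
head-tails (suc p) (b ∷ X) = head-tails p X

encodeBool-true≢nil : ∀ {t} → t ≡ encodeBool true → t ≢ nil
encodeBool-true≢nil refl ()

tails-exhausted : ∀ p ts → length ts ≤ p → tails p (encodeList ts) ≡ nil
tails-exhausted p       []       _         = tails-nil p
tails-exhausted (suc p) (t ∷ ts) (s≤s ≤p) = tails-exhausted p ts ≤p

tails-remaining : ∀ p ts → p < length ts → tails p (encodeList ts) ≢ nil
tails-remaining zero    (t ∷ ts) _         ()
tails-remaining (suc p) (t ∷ ts) (s≤s p<) = tails-remaining p ts p<

store : (t₀ t₁ t₂ t₃ t₄ t₅ t₆ t₇ t₈ t₉ t₁₀ t₁₁ : Tree) → Store 12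
store t₀ t₁ t₂ t₃ t₄ t₅ t₆ t₇ t₈ t₉ t₁₀ t₁₁ =
  t₀ ∷ t₁ ∷ t₂ ∷ t₃ ∷ t₄ ∷ t₅ ∷ t₆ ∷ t₇ ∷ t₈ ∷ t₉ ∷ t₁₀ ∷ t₁₁ ∷ []

private
  variable
    t₀ t₁ t₂ t₃ t₄ t₅ t₆ t₇ t₈ t₉ t₁₀ t₁₁ : Tree

advance-runs : ∀ p →
  advance ⊢ store t₀ t₁ t₂ t₃ t₄ t₅ t₆ t₇ t₈ (unary p) t₁₀ t₁₁
          ⇓ store t₀ t₁ t₂ t₃ t₄ t₅ t₆ t₇ t₈ nil (tails p t₁₀) (tails p t₁₁)
          within loopBound p 9
advance-runs zero    = loop-done refl
advance-runs (suc p) = loop-step (λ ()) (assign! then assign! then assign!) (advance-runs p)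

-- One summand per command of `examine`. The 9 is the body of `advance`; the 11 is the longest path
-- through the conditional, two tests of cost 3 followed by `keep` at cost 5.
scanBound : ℕ → ℕ
scanBound m = 2 + (4 + (4 + (loopBound m 9 + (11 + 3))))

-- `N` generalises the initial `kept`. The final values of `offset`, `left` and `right` are left
-- open, as `examine` overwrites these variables before reading them.
scan-runs : ∀ p W N → ∃ λ t₉′ → ∃₂ λ t₁₀′ t₁₁′ →
  scan ⊢ store t₀ t₁ t₂ t₃ (unary p) t₅ t₆ (encodePairs {l} W) (encodePairs N) t₉ t₁₀ t₁₁
       ⇓ store t₀ t₁ t₂ t₃ (unary p) t₅ (tails (count (separates p) W) t₆) nil
           (encodePairs (filterᵇ (not ∘ separates p) W ʳ++ N)) t₉′ t₁₀′ t₁₁′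
       within loopBound (length W) (scanBound p)
scan-runs p []            N = _ , _ , _ , loop-done refl
scan-runs p ((s , t) ∷ W) N with bit p s | head-tails p s | bit p t | head-tails p t
... | true | s≡ | true | t≡ with scan-runs p W ((s , t) ∷ N)
...   | _ , _ , _ , rest = _ , _ , _ , loop-step (λ ())
        (assign! then assign! then assign! then advance-runs p then
         weaken {T = 11} (≤ᵇ⇒≤ _ _ _) (branch-true (encodeBool-true≢nil s≡) (branch-true (encodeBool-true≢nil t≡) assign!)) then
         assign!) rest
scan-runs p ((s , t) ∷ W) N | true | s≡ | false | t≡ with scan-runs p W N
...   | _ , _ , _ , rest = _ , _ , _ , loop-step (λ ())
        (assign! then assign! then assign! then advance-runs p then
         weaken {T = 11} (≤ᵇ⇒≤ _ _ _) (branch-true (encodeBool-true≢nil s≡) (branch-false t≡ assign!)) then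
         assign!) rest
scan-runs p ((s , t) ∷ W) N | false | s≡ | _ | _ with scan-runs p W ((s , t) ∷ N)
...   | _ , _ , _ , rest = _ , _ , _ , loop-step (λ ())
        (assign! then assign! then assign! then advance-runs p then
         weaken {T = 11} (≤ᵇ⇒≤ _ _ _) (branch-false s≡ assign!) then
         assign!) rest

scanBound-mono : ∀ {p q} → p ≤ q → scanBound p ≤ scanBound q
scanBound-mono p≤q = +-monoʳ-≤ 10 (+-monoˡ-≤ 14 (loopBound-mono p≤q ≤-refl))

-- `L` bounds the number of pairs and `M` the positions. The 10 is the picking branch, which is the
-- dearer one.
visitBound : ℕ → ℕ → ℕ
visitBound L M = 2 + (2 + (2 + (loopBound L (scanBound M) + (10 + (3 + 4)))))

bits : Vec Bool l → List Tree
bits X = map encodeBool (toList X)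

-- The loop follows `pass` entry by entry: `tails-exhausted` and `tails-remaining` match the test of
-- `missing` with the comparison `θ ≤? count`. The sum `p + r` is constant, so `M` bounds every
-- position visited.
visits-runs : ∀ {L M} ts p (bs : Vec Bool r) (W : List (Pair l)) D →
  length W ≤ L → p + r ≤ M →
  let bs′ , W′ = pass (length ts) p bs W in
  ∀ {t₆ t₇ t₈ t₉ t₁₀ t₁₁} → ∃₂ λ t₄′ t₆′ → ∃₂ λ t₇′ t₈′ → ∃ λ t₉′ → ∃₂ λ t₁₀′ t₁₁′ →
  visits ⊢ store (encodeSubset bs) t₁ (encodePairs W) (encodeList ts)
             (unary p) (encodeList D) t₆ t₇ t₈ t₉ t₁₀ t₁₁
         ⇓ store nil t₁ (encodePairs W′) (encodeList ts)
             t₄′ (encodeList (bits bs′ ʳ++ D)) t₆′ t₇′ t₈′ t₉′ t₁₀′ t₁₁′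
         within loopBound r (visitBound L M)
visits-runs ts p [] W D W≤L p≤M = _ , _ , _ , _ , _ , _ , _ , loop-done refl
visits-runs {r = suc r} {L = L} {M} ts p (b ∷ bs) W D W≤L p≤M
  with length ts ≤? count (separates p) W | scan-runs p W []
... | yes θ≤ | _ , _ , _ , scanned
  with visits-runs ts (suc p) bs (unseparated p W) (encodeBool true ∷ D)
         (≤-trans (length-unseparated p W) W≤L) (≤-trans (≤-reflexive (sym (+-suc p r))) p≤M)
...   | _ , _ , _ , _ , _ , _ , _ , rest = _ , _ , _ , _ , _ , _ , _ , loop-step (λ ())
  (assign! then assign! then assign! then
   weaken (loopBound-mono W≤L (scanBound-mono (≤-trans (m≤m+n p _) p≤M))) scanned then
   weaken {T = 10} (≤ᵇ⇒≤ _ _ _) (branch-false (tails-exhausted _ ts θ≤) (assign! then assign!)) then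
   assign! then assign!) rest
visits-runs {r = suc r} {L = L} {M} ts p (b ∷ bs) W D W≤L p≤M | no θ≰ | _ , _ , _ , scanned
  with visits-runs ts (suc p) bs W (encodeBool b ∷ D)
         W≤L (≤-trans (≤-reflexive (sym (+-suc p r))) p≤M)
... | _ , _ , _ , _ , _ , _ , _ , rest = _ , _ , _ , _ , _ , _ , _ , loop-step (λ ())
  (assign! then assign! then assign! then
   weaken (loopBound-mono W≤L (scanBound-mono (≤-trans (m≤m+n p _) p≤M))) scanned then
   weaken {T = 10} (≤ᵇ⇒≤ _ _ _) (branch-true (tails-remaining _ ts (≰⇒> θ≰)) assign!) then
   assign! then assign!) rest

restore-runs : ∀ D {ts ts′} → D ʳ++ ts ≡ ts′ →
  restore ⊢ store (encodeList ts) t₁ t₂ t₃ t₄ (encodeList D) t₆ t₇ t₈ t₉ t₁₀ t₁₁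
          ⇓ store (encodeList ts′) t₁ t₂ t₃ t₄ nil t₆ t₇ t₈ t₉ t₁₀ t₁₁
          within loopBound (length D) 8
restore-runs []      refl = loop-done refl
restore-runs (t ∷ D) eq   = loop-step (λ ()) (assign! then assign!) (restore-runs D eq)

length-bits : ∀ (X : Vec Bool l) → length (bits X) ≡ l
length-bits X = trans (length-map encodeBool (toList X)) (length-toList X)

restore-bits : ∀ (X : Vec Bool l) →
  restore ⊢ store nil t₁ t₂ t₃ t₄ (encodeList (bits X ʳ++ [])) t₆ t₇ t₈ t₉ t₁₀ t₁₁
          ⇓ store (encodeSubset X) t₁ t₂ t₃ t₄ nil t₆ t₇ t₈ t₉ t₁₀ t₁₁
          within loopBound l 8
restore-bits X = weaken (loopBound-mono (≤-reflexive length≡) ≤-refl)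
  (restore-runs (bits X ʳ++ []) (trans (ʳ++-ʳ++ (bits X)) (++-identityʳ (bits X))))
  where
  length≡ : length (bits X ʳ++ []) ≡ _
  length≡ = trans (length-ʳ++ (bits X)) (trans (+-identityʳ _) (length-bits X))

roundBound : ℕ → ℕ → ℕ
roundBound L M = 2 + (2 + (loopBound M (visitBound L M) + (loopBound M 8 + 3)))

-- The equations for `t₀` and `τ` are premises because the initial answer is the list of elements,
-- equal to the code of `⊥` only by `encode-⊥`, and the initial level is the list of encoded pairs.
rounds-runs : ∀ {L M τ} ts (X : Subset l) (W : List (Pair l)) →
  t₀ ≡ encodeSubset X → length ts ≡ τ → length W ≤ L → l ≤ M →
  ∀ {t₄ t₅ t₆ t₇ t₈ t₉ t₁₀ t₁₁} → ∃ λ σ →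
  rounds ⊢ store t₀ t₁ (encodePairs W) (encodeList ts) t₄ t₅ t₆ t₇ t₈ t₉ t₁₀ t₁₁
         ⇓ encodeSubset (proj₁ (sweep τ X W)) ∷ σ
         within loopBound τ (roundBound L M)
rounds-runs []       X W refl refl W≤L l≤M = _ , loop-done refl
rounds-runs (t ∷ ts) X W refl refl W≤L l≤M with visits-runs (t ∷ ts) 0 X W [] W≤L l≤M
... | _ , _ , _ , _ , _ , _ , _ , visited
  with rounds-runs ts (proj₁ (pass (suc (length ts)) 0 X W)) (proj₂ (pass (suc (length ts)) 0 X W))
         refl refl (≤-trans (pass-length 0 X W) W≤L) l≤M
...   | _ , rest = _ , loop-step (λ ())
  (assign! then assign! then
   weaken (loopBound-mono l≤M ≤-refl) visited then
   weaken (loopBound-mono l≤M ≤-refl) (restore-bits (proj₁ (pass (suc (length ts)) 0 X W))) then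
   assign!) rest

encodeSets : List (Subset l) → Tree
encodeSets ss = encodeList (map encodeSubset ss)

pairRow-runs : ∀ (s : Subset l) ss W →
  pairRow ⊢ store t₀ t₁ (encodePairs W) t₃ t₄ t₅ t₆ t₇ t₈ t₉ (cons (encodeSubset s) t₁₀) (encodeSets ss)
          ⇓ store t₀ t₁ (encodePairs (map (s ,_) ss ʳ++ W)) t₃ t₄ t₅ t₆ t₇ t₈ t₉ (cons (encodeSubset s) t₁₀) nil
          within loopBound (length ss) 11
pairRow-runs s []       W = loop-done refl
pairRow-runs s (t ∷ ss) W = loop-step (λ ()) (assign! then assign!) (pairRow-runs s ss ((s , t) ∷ W))

pairRows-runs : ∀ (ss ts : List (Subset l)) W → ∃ λ t₁₁′ →
  pairRows ⊢ store t₀ (encodeSets ts) (encodePairs W) t₃ t₄ t₅ t₆ t₇ t₈ t₉ (encodeSets ss) t₁₁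
           ⇓ store t₀ (encodeSets ts) (encodePairs (cartesianProduct ss ts ʳ++ W)) t₃ t₄ t₅ t₆ t₇ t₈ t₉ nil t₁₁′
           within loopBound (length ss) (2 + (loopBound (length ts) 11 + 3))
pairRows-runs []       ts W = _ , loop-done refl
pairRows-runs (s ∷ ss) ts W
  rewrite ++-ʳ++ (map (_,_ s) ts) {cartesianProduct ss ts} {W}
  with pairRows-runs ss ts (map (s ,_) ts ʳ++ W)
... | _ , rest = _ , loop-step (λ ()) (assign! then pairRow-runs s ts W then assign!) rest

-- The input size `s` bounds both `m` and `n`, and `s * s` the number of pairs, which limits the
-- rounds as well as the length of each scan.
greedyBound : ℕ → ℕ
greedyBound s = 3 + (3 + (2 + (loopBound s (2 + (loopBound s 11 + 3)) +
                  (2 + loopBound (s * s) (roundBound (s * s) s)))))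

greedyBound-poly : PolyBounded greedyBound
greedyBound-poly =
  poly-+ (poly-const 3) (poly-+ (poly-const 3) (poly-+ (poly-const 2)
    (poly-+ (poly-loop poly-id (poly-+ (poly-const 2)
              (poly-+ (poly-loop poly-id (poly-const 11)) (poly-const 3))))
      (poly-+ (poly-const 2) (poly-loop square round′)))))
  where
  square = poly-* poly-id poly-id
  scan′ = poly-+ (poly-const 2) (poly-+ (poly-const 4) (poly-+ (poly-const 4)
            (poly-+ (poly-loop poly-id (poly-const 9)) (poly-const 14))))
  visit′ = poly-+ (poly-const 2) (poly-+ (poly-const 2) (poly-+ (poly-const 2)
             (poly-+ (poly-loop square scan′) (poly-const 17))))
  round′ = poly-+ (poly-const 2) (poly-+ (poly-const 2)
            (poly-+ (poly-loop poly-id visit′)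
              (poly-+ (poly-loop poly-id (poly-const 8)) (poly-const 3))))

length≤size : ∀ ts → length ts ≤ size (encodeList ts)
length≤size []       = z≤n
length≤size (t ∷ ts) = s≤s (≤-trans (length≤size ts) (m≤n+m _ (size t)))

encode-⊥ : ∀ k → encodeList (toList (replicate k nil)) ≡ encodeSubset (⊥ {n = k})
encode-⊥ zero    = refl
encode-⊥ (suc k) = cong (cons nil) (encode-⊥ k)

module _ (I : Instance) where

  private
    s : ℕ
    s = size (encodeInstance I)

    Bs : List (Subset (m I))
    Bs = toList (B I)

    elements : List Tree
    elements = toList (replicate (m I) nil)

  m≤size : m I ≤ s
  m≤size = begin
    m I                        ≡⟨ sym (length-toList (replicate (m I) Tree.nil)) ⟩
    length elements            ≤⟨ length≤size elements ⟩
    size (encodeList elements) ≤⟨ m≤m+n _ _ ⟩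
    _                          ≤⟨ n≤1+n _ ⟩
    s                          ∎
    where open ≤-Reasoning

  n≤size : length Bs ≤ s
  n≤size = begin
    length Bs                     ≡⟨ sym (length-map encodeSubset Bs) ⟩
    length (map encodeSubset Bs)  ≤⟨ length≤size (map encodeSubset Bs) ⟩
    size (encodeSets Bs)          ≤⟨ m≤n+m _ _ ⟩
    s                             ∎
    where open ≤-Reasoning

  pairs≤size² : length (pairs I) ≤ s * s
  pairs≤size² = ≤-trans (≤-reflexive (length-pairs I)) (*-mono-≤ n≤ n≤)
    where
    n≤ : n I ≤ s
    n≤ = ≤-trans (≤-reflexive (sym (length-toList (B I)))) n≤size

  greedy-runs : ∃ λ σ →
    greedy ⊢ encodeInstance I ∷ replicate 11 nil ⇓ encodeSubset (approx I) ∷ σ within greedyBound s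
  greedy-runs with pairRows-runs {t₀ = encodeList elements} Bs Bs []
  ... | _ , paired with rounds-runs (map encodePair (pairs I)) ⊥ (pairs I) (encode-⊥ (m I))
                          (length-map encodePair (pairs I)) pairs≤size² m≤size
  ...   | σ , rounded = σ , (assign! then assign! then assign! then
    weaken (loopBound-mono n≤size (+-monoʳ-≤ 2 (+-monoˡ-≤ 3 (loopBound-mono n≤size ≤-refl)))) paired then
    assign! then weaken (loopBound-mono pairs≤size² ≤-refl) rounded)

1≤size : ∀ t → 1 ≤ size t
1≤size nil        = s≤s z≤n
1≤size (cons _ _) = s≤s z≤n

polytime : ∀ {J : Set} {O : J → Set} {encodeIn : J → Tree} {encodeOut : ∀ {j} → O j → Tree}
             {f : ∀ j → O j} (c : Com (suc k)) {F} → PolyBounded F →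
           (∀ j → ∃ λ σ → c ⊢ encodeIn j ∷ replicate k nil ⇓ encodeOut (f j) ∷ σ
                           within F (size (encodeIn j))) →
           PolyTimeComputable encodeIn encodeOut f
polytime {k = k} {encodeIn = encodeIn} c (a , d , F≤) runs =
  (k , c) , a , d , λ j →
    let σ , run = runs j in
    time run , ≤-trans (in-time run) (F≤ _ (1≤size (encodeIn j))) , _ , execution run , refl

approx-polytime : PolyTimeComputable encodeInstance encodeSubset approx
approx-polytime = polytime {encodeOut = encodeSubset} {f = approx} greedy greedyBound-poly greedy-runs

mainTheorem7 : ∃ λ (approx : (I : Instance) → Subset (m I)) →
    PolyTimeComputable encodeInstance encodeSubset approx ×
    (∀ (I : Instance) → IsCompareSet I (approx I)) ×
    (∃ λ (c : ℕ) → ∀ (I : Instance) (X : Subset (m I)) → IsMinimumCompareSet I X →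
    ∣ approx I ∣ ≤ c * ⌊log₂ n I ⌋ * ∣ X ∣)
mainTheorem7 = approx , approx-polytime , approx-compare , 5 , approx-bound
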